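{- There exists a cubic graph of order $78$ that contains no cycle of length $4$, $8$ or $16$ (equivalently, no cycle of length $2^m$ for any $m \leq 4$). Consequently $f(4) \leq 78$.
   Context: Graphs are finite and simple (no loops or multiple edges). A graph is cubic if every vertex has degree $3$; the order of a graph is its number of vertices. A cycle of length $n$ (an $n$-cycle) is a subgraph isomorphic to the $n$-cycle, not necessarily induced. For an integer $k \geq 2$, $f(k)$ denotes the smallest order of a cubic graph with no $2^m$-cycles for all $m \leq k$ (since graphs are simple, only $m \geq 2$ is relevant). -}

module Defs where

open import Data.Fin using (Fin; toℕ)
open import Data.Fin.Subset using (Subset; _∈_; _∉_; ∣_∣)
open import Data.Nat using (ℕ; suc; _≤_; _^_; NonZero)
open import Data.Product using (∃-syntax; _×_)
open import Data.Sum using (_⊎_)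
open import Function.Definitions using (Injective)
open import Relation.Binary.PropositionalEquality using (_≡_)
open import Relation.Nullary using (¬_)

-- A finite simple graph of order n, given by the neighbourhoods of its
-- vertices.  The null graph is excluded, as usual: it is vacuously cubic and
-- has no cycles, so it would make f identically 0.
record Graph (n : ℕ) : Set where
  field
    nonempty      : NonZero n
    neighbourhood : Fin n → Subset n

  Adjacent : Fin n → Fin n → Set
  Adjacent u v = v ∈ neighbourhood u

  field
    symmetric : ∀ {u v} → Adjacent u v → Adjacent v u
    loopless  : ∀ v → v ∉ neighbourhood v

  degree : Fin n → ℕ
  degree v = ∣ neighbourhood v ∣

open Graph public using (Adjacent; degree)

Cubic : ∀ {n} → Graph n → Set
Cubic G = ∀ v → degree G v ≡ 3

-- j is the cyclic successor of i, i.e. j = i + 1 modulo ℓ.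
Next : ∀ {ℓ} → Fin ℓ → Fin ℓ → Set
Next {ℓ} i j = toℕ j ≡ suc (toℕ i) ⊎ (suc (toℕ i) ≡ ℓ × toℕ j ≡ 0)

-- A copy in G of the ℓ-cycle on Fin ℓ (whose edges join i to its cyclic
-- successor): the image is a subgraph isomorphic to the ℓ-cycle, which need
-- not be induced.
record Cycle {n} (G : Graph n) (ℓ : ℕ) : Set where
  field
    length≥3  : 3 ≤ ℓ
    vertex    : Fin ℓ → Fin n
    injective : Injective _≡_ _≡_ vertex
    adjacent  : ∀ {i j} → Next i j → Adjacent G (vertex i) (vertex j)

NoPowerOfTwoCycle≤ : ∀ {n} → ℕ → Graph n → Set
NoPowerOfTwoCycle≤ k G = ∀ m → m ≤ k → ¬ Cycle G (2 ^ m)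

Attained : ℕ → ℕ → Set
Attained k n = ∃[ G ] Cubic {n} G × NoPowerOfTwoCycle≤ k G

-- "f(k) = n".  This is a relation because f(k) is defined by minimality, and
-- a total function would presuppose that suitable graphs exist for every k.
IsF : ℕ → ℕ → Set
IsF k n = Attained k n × (∀ n′ → Attained k n′ → n ≤ n′)

{-# OPTIONS --safe #-}
-- Take the Petersen graph, replace one vertex by a gadget with 15 vertices and
-- each of the other nine by a gadget with 7 vertices (15 + 9 * 7 = 78), every
-- gadget having three vertices of degree 2 to which the outside edges attach.
-- The gadgets contain no cycle of length 4, 8 or 16.  Any other cycle follows a
-- cycle of the Petersen graph, which has length 5, 6, 8 or 9, and the gadgets
-- can be turned so that the passes through them add up to at least 17 vertices.
-- The absence of the three cycle lengths is checked by an exhaustive search,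
-- pruned by the distance back to the start.
--
-- The least order f(4) exists constructively because, for each order, a
-- suitable graph can be searched for among finitely many candidates.
module Submission where

open import Defs
open import Data.Bool using (Bool; true; false; not; _∧_; T)
open import Data.Bool.ListAction using (any)
open import Data.Bool.Properties using (T-∧)
open import Data.Fin using (Fin; toℕ)
import Data.Fin.Properties as Fin
open import Data.Fin.Subset using (Subset)
import Data.Fin.Subset as Subset
import Data.Fin.Subset.Properties as Subset
open import Data.List using (List; []; _∷_; head; drop; concatMap; deduplicate; upTo)
open import Data.List.Membership.Propositional using (lose)
open import Data.List.Membership.Propositional.Properties using (∈-concatMap⁺; ∈-deduplicate⁺; ∈-upTo⁺)
open import Data.List.Relation.Unary.All as All using (All; []; _∷_)
open import Data.List.Relation.Unary.Any as Any using (Any)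
open import Data.List.Relation.Unary.Any.Properties using (any⁺; any⁻)
open import Data.Maybe using (fromMaybe)
open import Data.Nat using (ℕ; zero; suc; _+_; _^_; _≤_; _<_; _≤?_; _≟_; _≡ᵇ_; s≤s; s≤s⁻¹; NonZero)
open import Data.Nat.DivMod using (_mod_; _%_; m%n<n; m<n⇒m%n≡m; n%n≡0)
open import Data.Nat.Induction using (<-rec)
open import Data.Nat.Properties
  using (≤-refl; ≤-trans; <⇒≤; <⇒≱; <-trans; ≮⇒≥; m<n⇒m<1+n; n≤1+n; m≤n+m; m≤n⇒m<n∨m≡n; +-suc; +-identityʳ; ≡⇒≡ᵇ; ≡ᵇ⇒≡; anyUpTo?; allUpTo?; nonZero?)
open import Data.Product using (Σ-syntax; ∃; ∃-syntax; _×_; _,_; proj₁; map₂)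
open import Data.Sum using (inj₁; inj₂)
open import Data.Unit using (tt)
open import Data.Vec using (Vec; []; _∷_; lookup; tabulate)
open import Data.Vec.Properties using (lookup∘tabulate; []=⇒lookup; lookup⇒[]=)
open import Function using (_∘_)
open import Function.Bundles using (_⇔_; mk⇔; Equivalence)
open import Relation.Binary.PropositionalEquality using (_≡_; refl; sym; trans; cong; subst; subst₂)
open import Relation.Nullary using (¬_; Dec; yes; no; does; contradiction)
open import Relation.Nullary.Decidable using (map′; dec-true; from-yes; from-no; ¬?; _×-dec_; _⊎-dec_; _→-dec_)
open import Relation.Unary using (Pred; Decidable)
open import Data.List.Membership.DecPropositional _≟_ using (_∈_; _∉_; _∈?_)

private variable
  n ℓ : ℕ

-- Subsets cut out by decidable predicates

subset : {P : Fin n → Set} → Decidable P → Subset n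
subset P? = tabulate (does ∘ P?)

∈-subset⁺ : {P : Fin n → Set} (P? : Decidable P) → ∀ {v} → P v → v Subset.∈ subset P?
∈-subset⁺ P? {v} p = lookup⇒[]= v _ (trans (lookup∘tabulate _ v) (dec-true (P? v) p))

∈-subset⁻ : {P : Fin n → Set} (P? : Decidable P) → ∀ {v} → v Subset.∈ subset P? → P v
∈-subset⁻ P? {v} v∈ with P? v | trans (sym (lookup∘tabulate (does ∘ P?) v)) ([]=⇒lookup v∈)
... | yes p | _  = p
... | no _  | ()

-- The graph

-- Row v lists the neighbours of v.  The large gadget is on 0 … 14; each later
-- line is a small gadget.
rows : List (List ℕ)
rows =
  ( 3 ∷  4 ∷ 71 ∷ []) ∷ ( 5 ∷  6 ∷ 57 ∷ []) ∷ ( 7 ∷  8 ∷ 64 ∷ []) ∷ ( 0 ∷  5 ∷  9 ∷ []) ∷ ( 0 ∷  7 ∷ 10 ∷ []) ∷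
  ( 1 ∷  3 ∷  9 ∷ []) ∷ ( 1 ∷ 11 ∷ 12 ∷ []) ∷ ( 2 ∷  4 ∷ 10 ∷ []) ∷ ( 2 ∷ 13 ∷ 14 ∷ []) ∷ ( 3 ∷  5 ∷ 11 ∷ []) ∷
  ( 4 ∷  7 ∷ 13 ∷ []) ∷ ( 6 ∷  9 ∷ 12 ∷ []) ∷ ( 6 ∷ 11 ∷ 14 ∷ []) ∷ ( 8 ∷ 10 ∷ 14 ∷ []) ∷ ( 8 ∷ 12 ∷ 13 ∷ []) ∷
  (18 ∷ 19 ∷ 51 ∷ []) ∷ (18 ∷ 20 ∷ 44 ∷ []) ∷ (19 ∷ 21 ∷ 72 ∷ []) ∷ (15 ∷ 16 ∷ 20 ∷ []) ∷ (15 ∷ 17 ∷ 21 ∷ []) ∷ (16 ∷ 18 ∷ 21 ∷ []) ∷ (17 ∷ 19 ∷ 20 ∷ []) ∷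
  (25 ∷ 26 ∷ 50 ∷ []) ∷ (25 ∷ 27 ∷ 37 ∷ []) ∷ (26 ∷ 28 ∷ 65 ∷ []) ∷ (22 ∷ 23 ∷ 27 ∷ []) ∷ (22 ∷ 24 ∷ 28 ∷ []) ∷ (23 ∷ 25 ∷ 28 ∷ []) ∷ (24 ∷ 26 ∷ 27 ∷ []) ∷
  (32 ∷ 33 ∷ 43 ∷ []) ∷ (32 ∷ 34 ∷ 36 ∷ []) ∷ (33 ∷ 35 ∷ 58 ∷ []) ∷ (29 ∷ 30 ∷ 34 ∷ []) ∷ (29 ∷ 31 ∷ 35 ∷ []) ∷ (30 ∷ 32 ∷ 35 ∷ []) ∷ (31 ∷ 33 ∷ 34 ∷ []) ∷
  (30 ∷ 39 ∷ 40 ∷ []) ∷ (23 ∷ 39 ∷ 41 ∷ []) ∷ (40 ∷ 42 ∷ 73 ∷ []) ∷ (36 ∷ 37 ∷ 41 ∷ []) ∷ (36 ∷ 38 ∷ 42 ∷ []) ∷ (37 ∷ 39 ∷ 42 ∷ []) ∷ (38 ∷ 40 ∷ 41 ∷ []) ∷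
  (29 ∷ 46 ∷ 47 ∷ []) ∷ (16 ∷ 46 ∷ 48 ∷ []) ∷ (47 ∷ 49 ∷ 66 ∷ []) ∷ (43 ∷ 44 ∷ 48 ∷ []) ∷ (43 ∷ 45 ∷ 49 ∷ []) ∷ (44 ∷ 46 ∷ 49 ∷ []) ∷ (45 ∷ 47 ∷ 48 ∷ []) ∷
  (22 ∷ 53 ∷ 54 ∷ []) ∷ (15 ∷ 53 ∷ 55 ∷ []) ∷ (54 ∷ 56 ∷ 59 ∷ []) ∷ (50 ∷ 51 ∷ 55 ∷ []) ∷ (50 ∷ 52 ∷ 56 ∷ []) ∷ (51 ∷ 53 ∷ 56 ∷ []) ∷ (52 ∷ 54 ∷ 55 ∷ []) ∷
  ( 1 ∷ 60 ∷ 61 ∷ []) ∷ (31 ∷ 60 ∷ 62 ∷ []) ∷ (52 ∷ 61 ∷ 63 ∷ []) ∷ (57 ∷ 58 ∷ 62 ∷ []) ∷ (57 ∷ 59 ∷ 63 ∷ []) ∷ (58 ∷ 60 ∷ 63 ∷ []) ∷ (59 ∷ 61 ∷ 62 ∷ []) ∷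
  ( 2 ∷ 67 ∷ 68 ∷ []) ∷ (24 ∷ 67 ∷ 69 ∷ []) ∷ (45 ∷ 68 ∷ 70 ∷ []) ∷ (64 ∷ 65 ∷ 69 ∷ []) ∷ (64 ∷ 66 ∷ 70 ∷ []) ∷ (65 ∷ 67 ∷ 70 ∷ []) ∷ (66 ∷ 68 ∷ 69 ∷ []) ∷
  ( 0 ∷ 74 ∷ 75 ∷ []) ∷ (17 ∷ 74 ∷ 76 ∷ []) ∷ (38 ∷ 75 ∷ 77 ∷ []) ∷ (71 ∷ 72 ∷ 76 ∷ []) ∷ (71 ∷ 73 ∷ 77 ∷ []) ∷ (72 ∷ 74 ∷ 77 ∷ []) ∷ (73 ∷ 75 ∷ 76 ∷ []) ∷ []

-- The search runs on plain naturals; the default `[]` leaves numbers from 78 on without neighbours.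
nbr : ℕ → List ℕ
nbr v = fromMaybe [] (head (drop v rows))

Joined : Fin 78 → Fin 78 → Set
Joined u v = toℕ v ∈ nbr (toℕ u)

joined? : ∀ u → Decidable (Joined u)
joined? u v = toℕ v ∈? nbr (toℕ u)

joined-symmetric : ∀ u v → Joined u v → Joined v u
joined-symmetric = from-yes (Fin.all? λ u → Fin.all? λ v → joined? u v →-dec joined? v u)

joined-loopless : ∀ v → ¬ Joined v v
joined-loopless = from-yes (Fin.all? λ v → ¬? (joined? v v))

G₇₈ : Graph 78
G₇₈ = record
  { nonempty      = _
  ; neighbourhood = λ u → subset (joined? u)
  ; symmetric     = λ {u} {v} → ∈-subset⁺ (joined? v) ∘ joined-symmetric u v ∘ ∈-subset⁻ (joined? u)
  ; loopless      = λ v → joined-loopless v ∘ ∈-subset⁻ (joined? v)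
  }

G₇₈-cubic : Cubic G₇₈
G₇₈-cubic = from-yes (Fin.all? λ v → degree G₇₈ v ≟ 3)

-- Search for cycles

infix 4 _∈ᵇ_

_∈ᵇ_ : ℕ → List ℕ → Bool
v ∈ᵇ vs = any (v ≡ᵇ_) vs

∈⇒∈ᵇ : ∀ {v vs} → v ∈ vs → T (v ∈ᵇ vs)
∈⇒∈ᵇ {v} = any⁺ (v ≡ᵇ_) ∘ Any.map (≡⇒≡ᵇ v _)

∈ᵇ⇒∈ : ∀ {v vs} → T (v ∈ᵇ vs) → v ∈ vs
∈ᵇ⇒∈ {v} {vs} = Any.map (≡ᵇ⇒≡ v _) ∘ any⁻ (v ≡ᵇ_) vs

∉⇒not-∈ᵇ : ∀ {v vs} → v ∉ vs → T (not (v ∈ᵇ vs))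
∉⇒not-∈ᵇ {v} {vs} v∉vs with v ∈ᵇ vs | ∈ᵇ⇒∈ {v} {vs}
... | true  | v∈vs = v∉vs (v∈vs tt)
... | false | _    = tt

T-∧⁺ : ∀ {b c} → T b → T c → T (b ∧ c)
T-∧⁺ p q = Equivalence.from T-∧ (p , q)

-- Does the path that visits vis and then u extend by k arbitrary steps followed
-- by one step into each of the given lists, never returning to vis (nor staying
-- at u, by looplessness)?  Boolean functions evaluate an order of magnitude
-- faster here than the corresponding Dec-valued ones.
extends : ℕ → List (List ℕ) → List ℕ → ℕ → Bool
extends (suc k) Ls       vis u = any (λ w → not (w ∈ᵇ vis) ∧ extends k Ls (u ∷ vis) w) (nbr u)
extends zero    (L ∷ Ls) vis u = any (λ w → (w ∈ᵇ L) ∧ not (w ∈ᵇ vis) ∧ extends zero Ls (u ∷ vis) w) (nbr u)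
extends zero    []       vis u = true

-- A path of m + k edges from s can only close up if its last m vertices are
-- joined to s by walks of m, …, 1 edges.  These m sets are accumulated in a list
-- so that each is evaluated only once per s.
spheres : List ℕ → ℕ → List (List ℕ) → List (List ℕ)
spheres L zero    Ls = Ls
spheres L (suc m) Ls = spheres (deduplicate _≟_ (concatMap nbr L)) m (L ∷ Ls)

closed : ℕ → ℕ → ℕ → Bool
closed m k s = extends k (spheres (nbr s) m []) [] s

-- Soundness of the search

module Soundness (f : ℕ → ℕ) (ℓ : ℕ)
  (forward  : ∀ {i} → i < ℓ → f (suc i) ∈ nbr (f i))
  (backward : ∀ {i} → i < ℓ → f i ∈ nbr (f (suc i)))
  (distinct : ∀ {i j} → i < ℓ → j < ℓ → f i ≡ f j → i ≡ j)
  where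

  data Passes : ℕ → List (List ℕ) → Set where
    []  : ∀ {i} → Passes i []
    _∷_ : ∀ {i L Ls} → i < ℓ × f i ∈ L → Passes (suc i) Ls → Passes i (L ∷ Ls)

  -- `spheres` grows from the closing end, so the induction follows the cycle backwards: if `L`
  -- contains a vertex of the cycle, the neighbours of `L` include its predecessor. The set current
  -- at `m = 0` is dropped and constrains nothing.
  passes-spheres : ∀ m {i L Ls} → m + i < ℓ → f (m + i) ∈ L →
    Passes (suc (m + i)) Ls → Passes (suc i) (spheres L m Ls)
  passes-spheres zero    m+i<ℓ f∈L ps = ps
  passes-spheres (suc m) m+i<ℓ f∈L ps = passes-spheres m (<⇒≤ m+i<ℓ)
    (∈-deduplicate⁺ _≟_ (∈-concatMap⁺ nbr (lose f∈L (backward (<⇒≤ m+i<ℓ)))))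
    ((m+i<ℓ , f∈L) ∷ ps)

  VisitedBefore : ℕ → List ℕ → Set
  VisitedBefore i = All (λ w → ∃[ j ] j < i × w ≡ f j)

  fresh : ∀ {i vis} → suc i < ℓ → VisitedBefore i vis → f (suc i) ∉ vis
  fresh 1+i<ℓ before f∈vis with All.lookup before f∈vis
  ... | j , j<i , eq with distinct 1+i<ℓ (<-trans j<i (<⇒≤ 1+i<ℓ)) eq
  ... | refl = <⇒≱ j<i (n≤1+n _)

  visit : ∀ {i vis} → VisitedBefore i vis → VisitedBefore (suc i) (f i ∷ vis)
  visit before = (_ , ≤-refl , refl) ∷ All.map (λ (j , j<i , eq) → j , m<n⇒m<1+n j<i , eq) before

  -- The cycle is its own witness: each `any` is satisfied by the next vertex, which is new by
  -- `distinct` and, once `k` is used up, lies in the required list by `Passes`.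
  extends⁺ : ∀ k {Ls} i {vis} → k + i < ℓ → Passes (suc (k + i)) Ls → VisitedBefore i vis → T (extends k Ls vis (f i))
  extends⁺ (suc k) {Ls} i k+i<ℓ ps before = any⁺ _ (lose (forward (<⇒≤ 1+i<ℓ))
    (T-∧⁺ (∉⇒not-∈ᵇ (fresh 1+i<ℓ before))
          (extends⁺ k (suc i) (subst (_< ℓ) eq k+i<ℓ) (subst (λ j → Passes (suc j) Ls) eq ps) (visit before))))
    where
    eq = sym (+-suc k i)
    1+i<ℓ = ≤-trans (s≤s (s≤s (m≤n+m i k))) k+i<ℓ
  extends⁺ zero i i<ℓ []                     before = tt
  extends⁺ zero i i<ℓ ((1+i<ℓ , f∈L) ∷ ps) before = any⁺ _ (lose (forward i<ℓ)
    (T-∧⁺ (∈⇒∈ᵇ f∈L) (T-∧⁺ (∉⇒not-∈ᵇ (fresh 1+i<ℓ before)) (extends⁺ zero (suc i) 1+i<ℓ ps (visit before)))))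

-- The `suc (m + k)` vertices are the start, `k` reached by free steps and `m` by pruned ones.
cycle⇒closed : ∀ m k → Cycle G₇₈ (suc (m + k)) → T (any (closed m k) (upTo 78))
cycle⇒closed m k C = any⁺ (closed m k) (lose (∈-upTo⁺ (Fin.toℕ<n (vertex (0 mod N))))
  (extends⁺ k 0 k+0<N passes []))
  where
  open Cycle C
  N = suc (m + k)

  -- Read modulo `N`, the cycle becomes a sequence with `f N` equal to `f 0`, so its closing edge is
  -- the ordinary step from `m + k` to `N`.
  f : ℕ → ℕ
  f i = toℕ (vertex (i mod N))

  toℕ-mod : ∀ i → toℕ (i mod N) ≡ i % N
  toℕ-mod i = Fin.toℕ-fromℕ< (m%n<n i N)

  toℕ-mod-< : ∀ {i} → i < N → toℕ (i mod N) ≡ i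
  toℕ-mod-< {i} i<N = trans (toℕ-mod i) (m<n⇒m%n≡m i<N)

  next : ∀ {i} → i < N → Next (i mod N) (suc i mod N)
  next {i} i<N with m≤n⇒m<n∨m≡n i<N
  ... | inj₁ 1+i<N = inj₁ (trans (toℕ-mod-< 1+i<N) (cong suc (sym (toℕ-mod-< i<N))))
  ... | inj₂ refl  = inj₂ (cong suc (toℕ-mod-< i<N) , trans (toℕ-mod N) (n%n≡0 N))

  forward : ∀ {i} → i < N → f (suc i) ∈ nbr (f i)
  forward {i} i<N = ∈-subset⁻ (joined? (vertex (i mod N))) (adjacent (next i<N))

  backward : ∀ {i} → i < N → f i ∈ nbr (f (suc i))
  backward {i} i<N = joined-symmetric (vertex (i mod N)) (vertex (suc i mod N)) (forward i<N)

  distinct : ∀ {i j} → i < N → j < N → f i ≡ f j → i ≡ j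
  distinct i<N j<N eq = subst₂ _≡_ (toℕ-mod-< i<N) (toℕ-mod-< j<N) (cong toℕ (injective (Fin.toℕ-injective eq)))

  open Soundness f N forward backward distinct using (Passes; []; passes-spheres; extends⁺)

  last∈nbr : f (m + k) ∈ nbr (f 0)
  last∈nbr = subst (λ i → f (m + k) ∈ nbr (toℕ (vertex i))) (Fin.toℕ-injective (trans (toℕ-mod N) (n%n≡0 N))) (backward ≤-refl)

  passes : Passes (suc (k + 0)) (spheres (nbr (f 0)) m [])
  passes = subst (λ i → Passes (suc i) (spheres (nbr (f 0)) m [])) (sym (+-identityʳ k))
    (passes-spheres m ≤-refl last∈nbr [])

  k+0<N : k + 0 < N
  k+0<N = s≤s (subst (_≤ m + k) (sym (+-identityʳ k)) (m≤n+m k m))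

-- The search evaluates to `false`, so `T` of it is the empty type. For `m ≥ 1` the last list is
-- `nbr s`, hence the way 3, 7 and 15 are split as `m + k` affects only the cost.
no-4-cycle : ¬ Cycle G₇₈ 4
no-4-cycle = cycle⇒closed 2 1

no-8-cycle : ¬ Cycle G₇₈ 8
no-8-cycle = cycle⇒closed 4 3

no-16-cycle : ¬ Cycle G₇₈ 16
no-16-cycle = cycle⇒closed 7 8

-- Decidability of the existence of a graph of given order

-- Functions on `Fin n` are searched for as vectors, entry by entry, which avoids function
-- extensionality.
anyVec? : {A : Set} → (∀ {P : A → Set} → Decidable P → Dec (∃ P)) →
          {P : Vec A n → Set} → Decidable P → Dec (∃ P)
anyVec? {n = zero}  any? P? = map′ ([] ,_) (λ { ([] , p) → p }) (P? [])
anyVec? {n = suc n} any? P? = map′ (λ (x , xs , p) → x ∷ xs , p) (λ { (x ∷ xs , p) → x , xs , p })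
  (any? λ x → anyVec? any? λ xs → P? (x ∷ xs))

adjacent? : (G : Graph n) → ∀ u v → Dec (Adjacent G u v)
adjacent? G u v = v Subset.∈? Graph.neighbourhood G u

next? : ∀ (i j : Fin ℓ) → Dec (Next i j)
next? {ℓ} i j = (toℕ j ≟ suc (toℕ i)) ⊎-dec ((suc (toℕ i) ≟ ℓ) ×-dec (toℕ j ≟ 0))

IsCycle : Graph n → (Fin ℓ → Fin n) → Set
IsCycle G c = (∀ i j → c i ≡ c j → i ≡ j) × (∀ i j → Next i j → Adjacent G (c i) (c j))

isCycle? : (G : Graph n) (c : Fin ℓ → Fin n) → Dec (IsCycle G c)
isCycle? G c =
  (Fin.all? λ i → Fin.all? λ j → (c i Fin.≟ c j) →-dec (i Fin.≟ j)) ×-dec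
  (Fin.all? λ i → Fin.all? λ j → next? i j →-dec adjacent? G (c i) (c j))

cycle? : (G : Graph n) → ∀ ℓ → Dec (Cycle G ℓ)
cycle? G ℓ = map′ to from ((3 ≤? ℓ) ×-dec anyVec? Fin.any? (isCycle? G ∘ lookup))
  where
  to : 3 ≤ ℓ × ∃ (IsCycle G ∘ lookup) → Cycle G ℓ
  to (3≤ℓ , c , inj , adj) = record
    { length≥3 = 3≤ℓ ; vertex = lookup c ; injective = inj _ _ ; adjacent = adj _ _ }

  from : Cycle G ℓ → 3 ≤ ℓ × ∃ (IsCycle G ∘ lookup)
  from C = length≥3 , tabulate vertex
    , (λ i j eq → injective (subst₂ _≡_ (lookup∘tabulate vertex i) (lookup∘tabulate vertex j) eq))
    , (λ i j i→j → subst₂ (Adjacent G) (sym (lookup∘tabulate vertex i)) (sym (lookup∘tabulate vertex j)) (adjacent i→j))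
    where open Cycle C

noPowerOfTwoCycle≤? : ∀ k (G : Graph n) → Dec (NoPowerOfTwoCycle≤ k G)
noPowerOfTwoCycle≤? k G = map′ (λ h m m≤k → h {m} (s≤s m≤k)) (λ h {m} m<1+k → h m (s≤s⁻¹ m<1+k))
  (allUpTo? (λ m → ¬? (cycle? G (2 ^ m))) (suc k))

cycle-mono : (G H : Graph n) → (∀ {u v} → Adjacent G u v → Adjacent H u v) → Cycle G ℓ → Cycle H ℓ
cycle-mono G H G⊆H C = record { Cycle C ; adjacent = G⊆H ∘ Cycle.adjacent C }

IsNeighbourhood : (Fin n → Subset n) → Set
IsNeighbourhood N = (∀ u v → v Subset.∈ N u → u Subset.∈ N v) × (∀ v → v Subset.∉ N v)

isNeighbourhood? : (N : Fin n → Subset n) → Dec (IsNeighbourhood N)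
isNeighbourhood? N =
  (Fin.all? λ u → Fin.all? λ v → (v Subset.∈? N u) →-dec (u Subset.∈? N v)) ×-dec
  (Fin.all? λ v → ¬? (v Subset.∈? N v))

graph : NonZero n → (N : Fin n → Subset n) → IsNeighbourhood N → Graph n
graph n≢0 N (symm , irr) = record { nonempty = n≢0 ; neighbourhood = N ; symmetric = symm _ _ ; loopless = irr }

attained? : ∀ k → Decidable (Attained k)
attained? k n with nonZero? n
... | no  n≡0 = no λ (G , _) → n≡0 (Graph.nonempty G)
... | yes n≢0 = map′ (λ (N , h , good) → graph n≢0 (lookup N) h , good) from
                     (anyVec? Subset.anySubset? λ N → suitable? (lookup N))
  where
  Good : Graph n → Set
  Good G = Cubic G × NoPowerOfTwoCycle≤ k G

  Suitable : (Fin n → Subset n) → Set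
  Suitable N = Σ[ h ∈ IsNeighbourhood N ] Good (graph n≢0 N h)

  good? : Decidable Good
  good? G = (Fin.all? λ v → degree G v ≟ 3) ×-dec noPowerOfTwoCycle≤? k G

  -- Graphs with the same neighbourhoods may differ in their proofs of symmetry and looplessness,
  -- but `Good` sees only the neighbourhoods.
  good-transport : (G H : Graph n) → (∀ v → Graph.neighbourhood G v ≡ Graph.neighbourhood H v) → Good G → Good H
  good-transport G H G≗H (cubic , no-cycle) =
    (λ v → trans (cong Subset.∣_∣ (sym (G≗H v))) (cubic v)) ,
    (λ m m≤k → no-cycle m m≤k ∘ cycle-mono H G λ {u} {v} → subst (v Subset.∈_) (sym (G≗H u)))

  suitable? : Decidable Suitable
  suitable? N with isNeighbourhood? N
  ... | no ¬h = no (¬h ∘ proj₁)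
  ... | yes h = map′ (h ,_) (λ (h′ , good) → good-transport (graph n≢0 N h′) (graph n≢0 N h) (λ _ → refl) good) (good? (graph n≢0 N h))

  from : Attained k n → ∃ (Suitable ∘ lookup)
  from (G , good) = tabulate N , h , good-transport G (graph n≢0 N′ h) (sym ∘ N′≗N) good
    where
    N  = Graph.neighbourhood G
    N′ = lookup (tabulate N)

    N′≗N : ∀ v → N′ v ≡ N v
    N′≗N = lookup∘tabulate N

    h : IsNeighbourhood N′
    h = (λ u v → subst (u Subset.∈_) (sym (N′≗N v)) ∘ Graph.symmetric G ∘ subst (v Subset.∈_) (N′≗N u))
      , (λ v → Graph.loopless G v ∘ subst (v Subset.∈_) (N′≗N v))

-- Least order and the bound on f(4)

least : ∀ {p} {P : Pred ℕ p} → Decidable P → ∀ n → P n → ∃[ m ] (P m × (∀ i → P i → m ≤ i)) × m ≤ n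
least {P = P} P? = <-rec _ step
  where
  step : ∀ n → (∀ {i} → i < n → P i → ∃[ m ] (P m × (∀ j → P j → m ≤ j)) × m ≤ i) →
         P n → ∃[ m ] (P m × (∀ j → P j → m ≤ j)) × m ≤ n
  -- Descend to a smaller solution if there is one; otherwise `n` is minimal.
  step n rec Pn with anyUpTo? P? n
  ... | yes (i , i<n , Pi) = map₂ (map₂ λ m≤i → ≤-trans m≤i (<⇒≤ i<n)) (rec i<n Pi)
  ... | no  none           = n , (Pn , λ i Pi → ≮⇒≥ λ i<n → none (i , i<n , Pi)) , ≤-refl

cycle-free⇔ : (G : Graph n) → (¬ Cycle G 4 × ¬ Cycle G 8 × ¬ Cycle G 16) ⇔ NoPowerOfTwoCycle≤ 4 G
cycle-free⇔ G = mk⇔ to (λ h → h 2 (from-yes (2 ≤? 4)) , h 3 (from-yes (3 ≤? 4)) , h 4 ≤-refl)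
  where
  to : ¬ Cycle G 4 × ¬ Cycle G 8 × ¬ Cycle G 16 → NoPowerOfTwoCycle≤ 4 G
  -- The powers 1 and 2 are too short to be cycle lengths.
  to _              0 _ C = contradiction (Cycle.length≥3 C) (from-no (3 ≤? 1))
  to _              1 _ C = contradiction (Cycle.length≥3 C) (from-no (3 ≤? 2))
  to (no4 , _)      2 _   = no4
  to (_ , no8 , _)  3 _   = no8
  to (_ , _ , no16) 4 _   = no16
  to _ (suc (suc (suc (suc (suc _))))) (s≤s (s≤s (s≤s (s≤s ()))))

mainTheorem2 : (Σ[ G ∈ Graph 78 ] (Cubic G × ¬ Cycle G 4 × ¬ Cycle G 8 × ¬ Cycle G 16))
    × ((n : ℕ) (G : Graph n) → (¬ Cycle G 4 × ¬ Cycle G 8 × ¬ Cycle G 16) ⇔ NoPowerOfTwoCycle≤ 4 G)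
    × (∃[ n ] (IsF 4 n × n ≤ 78))
mainTheorem2 =
  (G₇₈ , G₇₈-cubic , cycle-free) ,
  (λ _ → cycle-free⇔) ,
  least (attained? 4) 78 (G₇₈ , G₇₈-cubic , Equivalence.to (cycle-free⇔ G₇₈) cycle-free)
  where
  cycle-free : ¬ Cycle G₇₈ 4 × ¬ Cycle G₇₈ 8 × ¬ Cycle G₇₈ 16
  cycle-free = no-4-cycle , no-8-cycle , no-16-cycle
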